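{- Every signed digraph $G$ on $[n]$ ($n\geq 1$) admits a nilpotent function $f:\{0,1,2\}^n\to\{0,1,2\}^n$ of class at most $\lfloor\log_2 n\rfloor+2$.
   Context: A signed digraph is a digraph (loops allowed, no multiple arcs) in which each arc is labeled positive, negative, or null (unsigned). For a finite interval of integers $A$, a function over $A$ is a map $f:A^n\to A^n$; $f^0=\mathrm{id}$, $f^k=f\circ f^{k-1}$. The interaction graph $G(f)$ is the signed digraph on $[n]$ with an arc $(j,i)$ iff $f_i(a)\neq f_i(b)$ for some $a,b\in A^n$ with $a_j<b_j$ and $a_\ell=b_\ell$ for $\ell\neq j$; the arc is positive if $f_i(a)\leq f_i(b)$ for all such pairs, negative if $f_i(a)\geq f_i(b)$ for all such pairs, and null otherwise. $G$ admits $f$ if $G(f)=G$. $f$ is nilpotent if $f^k$ is constant for some $k\geq 0$; the least such $k$ is its class. -}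

module Defs where

open import Data.Fin using (Fin; _<_; _≤_)
open import Data.Fin.Properties using (_≟_; _<?_; _≤?_; all?; any?)
open import Data.Maybe using (Maybe; just; nothing)
import Data.Nat as ℕ
open import Data.Nat using (ℕ; zero; suc)
open import Data.Product using (∃; ∃-syntax; _×_; _,_)
open import Data.Vec using (Vec; []; _∷_; lookup)
open import Function using (id; _∘_)
open import Relation.Binary.PropositionalEquality using (_≡_; _≢_)
open import Relation.Nullary using (Dec; yes; no; ¬?; _×-dec_; _→-dec_)
open import Relation.Nullary.Decidable using (map′)

data Label : Set where
  positive negative null : Label

-- G j i describes the ordered pair (j , i): `nothing` if there is no arc from
-- j to i, and `just s` if there is one, with label s.
SignedDigraph : ℕ → Set
SignedDigraph n = Fin n → Fin n → Maybe Label

infix 4 _≐_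

_≐_ : ∀ {n} → SignedDigraph n → SignedDigraph n → Set
G ≐ H = ∀ j i → G j i ≡ H j i

-- The interval A = {0, …, q-1} is Fin q, with its usual order.
State : ℕ → ℕ → Set
State q n = Vec (Fin q) n

FunctionOver : ℕ → ℕ → Set
FunctionOver q n = State q n → State q n

module _ {q n : ℕ} where

  infix 4 _<[_]_

  _<[_]_ : State q n → Fin n → State q n → Set
  a <[ j ] b =
    lookup a j < lookup b j × (∀ ℓ → ℓ ≢ j → lookup a ℓ ≡ lookup b ℓ)

  Arc : FunctionOver q n → Fin n → Fin n → Set
  Arc f j i = ∃[ a ] ∃[ b ] (a <[ j ] b × lookup (f a) i ≢ lookup (f b) i)

  NonDecreasing : FunctionOver q n → Fin n → Fin n → Set
  NonDecreasing f j i = ∀ a b → a <[ j ] b → lookup (f a) i ≤ lookup (f b) i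

  NonIncreasing : FunctionOver q n → Fin n → Fin n → Set
  NonIncreasing f j i = ∀ a b → a <[ j ] b → lookup (f b) i ≤ lookup (f a) i

∀State? : ∀ {q} n {P : State q n → Set} →
          (∀ a → Dec (P a)) → Dec (∀ a → P a)
∀State? zero    P? = map′ (λ { p [] → p }) (λ h → h []) (P? [])
∀State? (suc n) P? =
  map′ (λ { h (x ∷ a) → h x a }) (λ h x a → h (x ∷ a))
       (all? λ x → ∀State? n λ a → P? (x ∷ a))

∃State? : ∀ {q} n {P : State q n → Set} →
          (∀ a → Dec (P a)) → Dec (∃ P)
∃State? zero    P? = map′ (λ p → [] , p) (λ { ([] , p) → p }) (P? [])
∃State? (suc n) P? =
  map′ (λ { (x , a , p) → x ∷ a , p }) (λ { (x ∷ a , p) → x , a , p })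
       (any? λ x → ∃State? n λ a → P? (x ∷ a))

module _ {q n : ℕ} where

  <[]? : (a : State q n) (j : Fin n) (b : State q n) → Dec (a <[ j ] b)
  <[]? a j b =
    (lookup a j <? lookup b j)
      ×-dec all? λ ℓ → ¬? (ℓ ≟ j) →-dec (lookup a ℓ ≟ lookup b ℓ)

  arc? : (f : FunctionOver q n) (j i : Fin n) → Dec (Arc f j i)
  arc? f j i = ∃State? n λ a → ∃State? n λ b →
    <[]? a j b ×-dec ¬? (lookup (f a) i ≟ lookup (f b) i)

  nonDecreasing? : (f : FunctionOver q n) (j i : Fin n) →
                   Dec (NonDecreasing f j i)
  nonDecreasing? f j i = ∀State? n λ a → ∀State? n λ b →
    <[]? a j b →-dec (lookup (f a) i ≤? lookup (f b) i)

  nonIncreasing? : (f : FunctionOver q n) (j i : Fin n) →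
                   Dec (NonIncreasing f j i)
  nonIncreasing? f j i = ∀State? n λ a → ∀State? n λ b →
    <[]? a j b →-dec (lookup (f b) i ≤? lookup (f a) i)

-- When there is an arc, at most one of the last two decisions is `yes`, so
-- their order of inspection is immaterial.
arcLabel : ∀ {X Y Z : Set} → Dec X → Dec Y → Dec Z → Maybe Label
arcLabel (no  _) _       _       = nothing
arcLabel (yes _) (yes _) _       = just positive
arcLabel (yes _) (no  _) (yes _) = just negative
arcLabel (yes _) (no  _) (no  _) = just null

interactionGraph : ∀ {q n} → FunctionOver q n → SignedDigraph n
interactionGraph f j i =
  arcLabel (arc? f j i) (nonDecreasing? f j i) (nonIncreasing? f j i)

Admits : ∀ {q n} → SignedDigraph n → FunctionOver q n → Set
Admits G f = interactionGraph f ≐ G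

module _ {q n : ℕ} where

  infixr 8 _^_

  _^_ : FunctionOver q n → ℕ → FunctionOver q n
  f ^ zero  = id
  f ^ suc k = f ∘ (f ^ k)

  Constant : FunctionOver q n → Set
  Constant g = ∀ a b → g a ≡ g b

  Nilpotent : FunctionOver q n → Set
  Nilpotent f = ∃[ k ] Constant (f ^ k)

  IsClass : FunctionOver q n → ℕ → Set
  IsClass f k = Constant (f ^ k) × (∀ m → Constant (f ^ m) → k ℕ.≤ m)

{-# OPTIONS --safe #-}
module Submission where

-- Each vertex i with an in-neighbour selects one, φ i, and f_i is a
-- conjunction of one literal per in-neighbour, possibly complemented, so that
-- f_i takes two values: 0 and a ceiling, 1 or 2. Null arcs test for the value
-- 1 and signed arcs for the value 2. Hence a vertex with range {0,1} sends no
-- information along its signed arcs, and one with range {0,2} none along its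
-- null arcs, and on the range of f the literal of a blocked selected arc can
-- be made false, which makes f_i constant. Information only survives along
-- the selected arcs of the other class, and there the literal is chosen to be
-- false at the limit value of φ i, so that f_i settles one step after φ i.
-- Each vertex blocks the class of its selected out-arcs with more descendants.
-- This blocks all cycles of φ, and the number of descendants more than doubles
-- along each surviving arc that does not end on a cycle, so a surviving path
-- has at most log₂ n arcs.

open import Defs
open import Data.Bool using (Bool; true; false; not; _∧_; _xor_; if_then_else_)
import Data.Bool.Properties as Bool
open import Data.Fin as Fin using (Fin; zero; suc; toℕ; fromℕ<)
open import Data.Fin.Patterns using (0F; 1F; 2F)
import Data.Fin.Properties as Fin
open import Data.Maybe using (Maybe; just; nothing; is-just)
open import Data.Nat using (ℕ; zero; suc; _+_; _*_; _∸_; _≤_; _<_; _≥_; z≤n; s≤s) renaming (_^_ to _^ℕ_)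
open import Data.Nat.Logarithm using (⌊log₂_⌋; ⌊log₂⌋-mono-≤; ⌊log₂[2^n]⌋≡n)
import Data.Nat.Properties as ℕ
open import Data.Nat.Tactic.RingSolver using (solve-∀)
open import Data.Product using (∃; ∃-syntax; _×_; _,_; proj₁; proj₂)
open import Data.Sum using (_⊎_; inj₁; inj₂)
open import Data.Unit using (⊤; tt)
open import Data.Vec using (Vec; lookup; tabulate)
import Data.Vec.Properties as Vec
open import Function using (_∘_; id)
open import Relation.Binary using (tri<; tri≈; tri>)
open import Relation.Binary.PropositionalEquality using (_≡_; _≢_; refl; sym; trans; cong; cong₂; subst; subst₂; module ≡-Reasoning)
open import Relation.Nullary using (¬_; Dec; yes; no; does; contradiction; _×-dec_; _⊎-dec_; _→-dec_; ¬?)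
open import Relation.Nullary.Decidable using (map′; dec-true; dec-false)

-- Counting decidable subsets of `Fin n`.

card : ∀ {n} {P : Fin n → Set} → (∀ v → Dec (P v)) → ℕ
card {zero}  P? = 0
card {suc n} P? = (if does (P? zero) then 1 else 0) + card (P? ∘ suc)

card≤n : ∀ {n} {P : Fin n → Set} (P? : ∀ v → Dec (P v)) → card P? ≤ n
card≤n {zero}  P? = z≤n
card≤n {suc n} P? with P? zero
... | yes _ = s≤s (card≤n (P? ∘ suc))
... | no  _ = ℕ.m≤n⇒m≤1+n (card≤n (P? ∘ suc))

card-nonempty : ∀ {n} {P : Fin n → Set} (P? : ∀ v → Dec (P v)) → ∃ P → 1 ≤ card P?
card-nonempty P? (zero , p) with P? zero
... | yes _ = s≤s z≤n
... | no ¬p = contradiction p ¬p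
card-nonempty P? (suc v , p) =
  ℕ.≤-trans (card-nonempty (P? ∘ suc) (v , p)) (ℕ.m≤n+m _ _)

card-disjoint : ∀ {n} {P Q R : Fin n → Set}
  (P? : ∀ v → Dec (P v)) (Q? : ∀ v → Dec (Q v)) (R? : ∀ v → Dec (R v)) →
  (∀ v → P v → ¬ Q v) → (∀ v → P v → R v) → (∀ v → Q v → R v) →
  card P? + card Q? ≤ card R?
card-disjoint {zero}  P? Q? R? P∩Q P⊆R Q⊆R = z≤n
card-disjoint {suc n} P? Q? R? P∩Q P⊆R Q⊆R
  with P? zero | Q? zero | R? zero
     | card-disjoint (P? ∘ suc) (Q? ∘ suc) (R? ∘ suc) (P∩Q ∘ suc) (P⊆R ∘ suc) (Q⊆R ∘ suc)
... | yes p | yes q | _     | _  = contradiction q (P∩Q zero p)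
... | yes p | no _  | yes _ | ih = s≤s ih
... | yes p | no _  | no ¬r | _  = contradiction (P⊆R zero p) ¬r
... | no _  | yes q | yes _ | ih = ℕ.≤-trans (ℕ.≤-reflexive (ℕ.+-suc _ _)) (s≤s ih)
... | no _  | yes q | no ¬r | _  = contradiction (Q⊆R zero q) ¬r
... | no _  | no _  | yes _ | ih = ℕ.m≤n⇒m≤1+n ih
... | no _  | no _  | no _  | ih = ih

card-mono : ∀ {n} {P R : Fin n → Set} (P? : ∀ v → Dec (P v)) (R? : ∀ v → Dec (R v)) →
  (∀ v → P v → R v) → card P? ≤ card R?
card-mono P? R? P⊆R = ℕ.≤-trans (ℕ.m≤m+n _ _)
  (card-disjoint P? (λ _ → no id) R? (λ _ _ ()) P⊆R (λ _ ()))

card-insert : ∀ {n} {P R : Fin n → Set} (P? : ∀ v → Dec (P v)) (R? : ∀ v → Dec (R v)) (u : Fin n) →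
  ¬ P u → R u → (∀ v → P v → R v) → 1 + card P? ≤ card R?
card-insert P? R? u ¬Pu Ru P⊆R = ℕ.≤-trans
  (ℕ.+-monoˡ-≤ _ (card-nonempty (Fin._≟ u) (u , refl)))
  (card-disjoint (Fin._≟ u) P? R? (λ { _ refl → ¬Pu }) (λ { _ refl → Ru }) P⊆R)

-- Orbits of `φ`, descendants and surviving arcs.

abstract
  lighter : (w : Bool → ℕ) → ∃[ c ] (w c ≤ w (not c))
  lighter w with ℕ.≤-total (w true) (w false)
  ... | inj₁ le = true , le
  ... | inj₂ le = false , le

-- Every vertex i is hung below φ i by an arc of one of two classes.
module LighterClass {n : ℕ} (φ : Fin n → Fin n) (class : Fin n → Bool) where

  iter : ℕ → Fin n → Fin n
  iter zero    v = v
  iter (suc t) v = iter t (φ v)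

  iter-+ : ∀ s t v → iter (s + t) v ≡ iter t (iter s v)
  iter-+ zero    t v = refl
  iter-+ (suc s) t v = iter-+ s t (φ v)

  iter-φ : ∀ t v → iter t (φ v) ≡ φ (iter t v)
  iter-φ zero    v = refl
  iter-φ (suc t) v = iter-φ t (φ v)

  iter-hit : ∀ t {v i j} → iter t v ≡ i → φ i ≡ j → iter (suc t) v ≡ j
  iter-hit t {v} eq φi = trans (iter-φ t v) (trans (cong φ eq) φi)

  iter-* : ∀ m {p v} → iter p v ≡ v → iter (m * p) v ≡ v
  iter-* zero            eq = refl
  iter-* (suc m) {p} {v} eq =
    trans (iter-+ p (m * p) v) (trans (cong (iter (m * p)) eq) (iter-* m eq))

  Bounded : ℕ → Fin n → Set
  Bounded t v = ∃[ s ] (iter (toℕ {n} s) v ≡ iter t v)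

  -- Among the iterates numbered `0` to `n` two coincide, and cutting out the loop between them
  -- shortens the walk of length `n`. This leads to a bounded search for `Reaches`, hence to its
  -- decidability.
  bounded-n : ∀ v → Bounded n v
  bounded-n v with Fin.pigeonhole (ℕ.n<1+n n) (λ k → iter (toℕ k) v)
  ... | a , b , a<b , eq = fromℕ< r<n , trans (cong (λ s → iter s v) (Fin.toℕ-fromℕ< r<n)) same
    where
    d = n ∸ toℕ b
    b+d≡n : toℕ b + d ≡ n
    b+d≡n = ℕ.m+[n∸m]≡n (ℕ.≤-pred (Fin.toℕ<n b))
    r<n : toℕ a + d < n
    r<n = subst (toℕ a + d <_) b+d≡n (ℕ.+-monoˡ-< d a<b)
    open ≡-Reasoning
    same : iter (toℕ a + d) v ≡ iter n v
    same = begin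
      iter (toℕ a + d) v       ≡⟨ iter-+ (toℕ a) d v ⟩
      iter d (iter (toℕ a) v)  ≡⟨ cong (iter d) eq ⟩
      iter d (iter (toℕ b) v)  ≡⟨ sym (iter-+ (toℕ b) d v) ⟩
      iter (toℕ b + d) v       ≡⟨ cong (λ s → iter s v) b+d≡n ⟩
      iter n v                 ∎

  bounded : ∀ t v → Bounded t v
  bounded zero    v = fromℕ< 0<n , cong (λ k → iter k v) (Fin.toℕ-fromℕ< 0<n)
    where 0<n = ℕ.≤-trans (s≤s z≤n) (Fin.toℕ<n v)
  bounded (suc t) v with bounded t v
  ... | s , eq with ℕ.m≤n⇒m<n∨m≡n (Fin.toℕ<n s) | trans (iter-hit (toℕ s) eq refl) (sym (iter-φ t v))
  ...   | inj₁ s+1<n | step = fromℕ< s+1<n , trans (cong (λ k → iter k v) (Fin.toℕ-fromℕ< s+1<n)) step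
  ...   | inj₂ s+1≡n | step with bounded-n v
  ...     | r , eq′ = r , trans eq′ (trans (cong (λ k → iter k v) (sym s+1≡n)) step)

  Reaches : Fin n → Fin n → Set
  Reaches v i = ∃[ t ] (iter t v ≡ i)

  reaches? : ∀ i v → Dec (Reaches v i)
  reaches? i v = map′ (λ (s , eq) → toℕ s , eq)
    (λ (t , eq) → let s , eq′ = bounded t v in s , trans eq′ eq)
    (Fin.any? λ s → iter (toℕ s) v Fin.≟ i)

  reaches-trans : ∀ {u v w} → Reaches u v → Reaches v w → Reaches u w
  reaches-trans {u} (s , refl) (t , eq) = s + t , trans (iter-+ s t u) eq

  reaches-φ : ∀ {v i} → Reaches v i → Reaches v (φ i)
  reaches-φ {v} (t , refl) = suc t , iter-φ t v

  -- When `j` lies on a cycle, a vertex may enter `j` through children of both classes, since the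
  -- walk can continue around the cycle. Off the cycles the classes are disjoint (`via-disjoint`).
  Via : Fin n → Bool → Fin n → Set
  Via j c v = ∃[ i ] (class i ≡ c × φ i ≡ j × Reaches v i)

  via? : ∀ j c v → Dec (Via j c v)
  via? j c v = Fin.any? λ i → (class i Bool.≟ c) ×-dec (φ i Fin.≟ j) ×-dec reaches? i v

  size : Fin n → ℕ
  size i = card (reaches? i)

  load : Fin n → Bool → ℕ
  load j c = card (via? j c)

  keep : Fin n → Bool
  keep j = proj₁ (lighter (load j))

  load-keep : ∀ j → load j (keep j) ≤ load j (not (keep j))
  load-keep j = proj₂ (lighter (load j))

  Survives : Fin n → Set
  Survives i = class i ≡ keep (φ i)

  survives? : ∀ i → Dec (Survives i)
  survives? i = class i Bool.≟ keep (φ i)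

  Periodic : Fin n → Set
  Periodic i = Reaches (φ i) i

  -- Both `suc t` and `suc t′` are periods of `j`. Prefixing `t′` turns of the first to the walk to
  -- `i`, and `t` turns of the second to the walk to `i′`, keeps the endpoints and makes the lengths
  -- equal.
  periodic-child-unique : ∀ {j i i′} → φ i ≡ j → φ i′ ≡ j → Reaches j i → Reaches j i′ → i ≡ i′
  periodic-child-unique {j} {i} {i′} φi φi′ (t , eq) (t′ , eq′) = begin
    i                          ≡⟨ sym eq ⟩
    iter t j                   ≡⟨ cong (iter t) (sym (iter-* t′ (iter-hit t eq φi))) ⟩
    iter t (iter (t′ * suc t) j) ≡⟨ sym (iter-+ (t′ * suc t) t j) ⟩
    iter (t′ * suc t + t) j    ≡⟨ cong (λ k → iter k j) (arith t t′) ⟩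
    iter (t * suc t′ + t′) j   ≡⟨ iter-+ (t * suc t′) t′ j ⟩
    iter t′ (iter (t * suc t′) j) ≡⟨ cong (iter t′) (iter-* t (iter-hit t′ eq′ φi′)) ⟩
    iter t′ j                  ≡⟨ eq′ ⟩
    i′                         ∎
    where
    open ≡-Reasoning
    arith : ∀ a b → b * suc a + a ≡ a * suc b + b
    arith = solve-∀

  -- If i lay on a cycle, everything hung below φ i, and φ i itself, would
  -- reach φ i through i, so the class of i would be strictly the heavier one.
  survives⇒¬periodic : ∀ {i} → Survives i → ¬ Periodic i
  survives⇒¬periodic {i} surv per = ℕ.<⇒≱ heavier (load-keep j)
    where
    j = φ i
    -- `j` supplies the strictness: the only child of `j` that `j` reaches is `i`, and its class is
    -- the kept one.
    notVia : ¬ Via j (not (keep j)) j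
    notVia (i′ , c , φi′ , r) with periodic-child-unique refl φi′ per r
    ... | refl = Bool.not-¬ refl (trans (sym surv) c)
    heavier : load j (not (keep j)) < load j (keep j)
    heavier = card-insert (via? j _) (via? j _) j notVia (i , surv , refl , per)
      λ { v (i′ , _ , φi′ , r) →
        i , surv , refl , reaches-trans (subst (Reaches v) φi′ (reaches-φ r)) per }

  later-visit-periodic : ∀ {v j s s′} → s < s′ → iter s v ≡ j → iter s′ v ≡ j → Periodic j
  later-visit-periodic {v} {j} {s} s<s′ eq eq′ with ℕ.m≤n⇒∃[o]m+o≡n s<s′
  ... | k , refl = k , (begin
    iter k (φ j)            ≡⟨ cong (iter (suc k)) (sym eq) ⟩
    iter (suc k) (iter s v) ≡⟨ sym (iter-+ s (suc k) v) ⟩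
    iter (s + suc k) v      ≡⟨ cong (λ m → iter m v) (ℕ.+-suc s k) ⟩
    iter (suc (s + k)) v    ≡⟨ eq′ ⟩
    j                       ∎)
    where open ≡-Reasoning

  -- A walk meets a non-periodic `j` at most once, so its start determines the child through which
  -- it enters `j`.
  via-disjoint : ∀ {j c c′} → ¬ Periodic j → c ≢ c′ → ∀ v → Via j c v → ¬ Via j c′ v
  via-disjoint {j} ¬per c≢c′ v (i , refl , φi , s , eq) (i′ , refl , φi′ , s′ , eq′)
    with ℕ.<-cmp s s′
  ... | tri< s<s′ _ _ = ¬per (later-visit-periodic (s≤s s<s′) (iter-hit s eq φi) (iter-hit s′ eq′ φi′))
  ... | tri≈ _ refl _ = c≢c′ (cong class (trans (sym eq) eq′))
  ... | tri> _ _ s′<s = ¬per (later-visit-periodic (s≤s s′<s) (iter-hit s′ eq′ φi′) (iter-hit s eq φi))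

  via⇒reaches : ∀ {j c} v → Via j c v → Reaches v j
  via⇒reaches v (i , _ , φi , r) = subst (Reaches v) φi (reaches-φ r)

  ¬via-self : ∀ {j c} → ¬ Periodic j → ¬ Via j c j
  ¬via-self ¬per (i , _ , refl , t , eq) =
    ¬per (t , trans (iter-φ t (φ i)) (cong φ eq))

  -- All descendants of `i` count towards the kept load of `φ i`, which is at most the blocked load,
  -- so the two loads together are at least twice `size i`. They count disjoint sets, and `φ i`
  -- itself, in neither set, gives the `1`.
  size-doubles : ∀ {i} → Survives i → ¬ Periodic (φ i) → 1 + (size i + size i) ≤ size (φ i)
  size-doubles {i} surv ¬per = begin
    1 + (size i + size i)                           ≤⟨ s≤s (ℕ.+-mono-≤ size≤ (ℕ.≤-trans size≤ (load-keep j))) ⟩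
    1 + (load j (keep j) + load j (not (keep j)))   ≤⟨ s≤s (card-disjoint (via? j _) (via? j _) either?
                                                         (via-disjoint ¬per (Bool.not-¬ refl))
                                                         (λ _ → inj₁) (λ _ → inj₂)) ⟩
    1 + card either?                                ≤⟨ card-insert either? (reaches? j) j
                                                         (λ { (inj₁ p) → ¬via-self ¬per p ; (inj₂ p) → ¬via-self ¬per p })
                                                         (0 , refl)
                                                         (λ { v (inj₁ p) → via⇒reaches v p ; v (inj₂ p) → via⇒reaches v p }) ⟩
    size j                                          ∎
    where
    open ℕ.≤-Reasoning
    j = φ i
    either? : ∀ v → Dec (Via j (keep j) v ⊎ Via j (not (keep j)) v)
    either? v = via? j (keep j) v ⊎-dec via? j (not (keep j)) v
    size≤ : size i ≤ load j (keep j)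
    size≤ = card-mono (reaches? i) (via? j _) λ v r → i , surv , refl , r

  size-grows : ∀ {i} → Survives i → 1 + size i ≤ size (φ i)
  size-grows {i} surv = card-insert (reaches? i) (reaches? (φ i)) (φ i)
    (survives⇒¬periodic surv) (0 , refl) (λ _ → reaches-φ)

  Chain : ℕ → Fin n → Set
  Chain zero    i = ⊤
  Chain (suc d) i = Survives i × Chain d (φ i)

  -- Only the top of a chain may lie on a cycle, which is why the last arc
  -- is treated by size-grows and all others by size-doubles.
  chain-size : ∀ d m {i} → Chain (suc d) i → m ≤ 1 + size i → 2 ^ℕ d * m ≤ n
  chain-size zero m {i} (surv , _) m≤ = begin
    1 * m         ≡⟨ ℕ.*-identityˡ m ⟩
    m             ≤⟨ m≤ ⟩
    1 + size i    ≤⟨ size-grows surv ⟩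
    size (φ i)    ≤⟨ card≤n (reaches? (φ i)) ⟩
    n             ∎
    where open ℕ.≤-Reasoning
  chain-size (suc d) m {i} (surv , chain@(surv′ , _)) m≤ = begin
    2 * 2 ^ℕ d * m     ≡⟨ cong (_* m) (ℕ.*-comm 2 (2 ^ℕ d)) ⟩
    2 ^ℕ d * 2 * m     ≡⟨ ℕ.*-assoc (2 ^ℕ d) 2 m ⟩
    2 ^ℕ d * (2 * m)   ≤⟨ chain-size d (2 * m) chain doubled ⟩
    n                  ∎
    where
    open ℕ.≤-Reasoning
    arith : ∀ a → 2 * (1 + a) ≡ 1 + (1 + (a + a))
    arith = solve-∀
    -- The invariant bounds `1 + size` rather than `size`: the extra `1` in `size-doubles` is just
    -- what makes this quantity double.
    doubled : 2 * m ≤ 1 + size (φ i)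
    doubled = begin
      2 * m                        ≤⟨ ℕ.*-monoʳ-≤ 2 m≤ ⟩
      2 * (1 + size i)             ≡⟨ arith (size i) ⟩
      1 + (1 + (size i + size i))  ≤⟨ s≤s (size-doubles surv (survives⇒¬periodic surv′)) ⟩
      1 + size (φ i)               ∎

  ¬long-chain : ∀ i → ¬ Chain (suc ⌊log₂ n ⌋) i
  ¬long-chain i chain = ℕ.<-irrefl refl (begin-strict
    ⌊log₂ n ⌋                         <⟨ ℕ.n<1+n _ ⟩
    suc ⌊log₂ n ⌋                     ≡⟨ sym (⌊log₂[2^n]⌋≡n _) ⟩
    ⌊log₂ 2 ^ℕ suc ⌊log₂ n ⌋ ⌋        ≤⟨ ⌊log₂⌋-mono-≤ pow≤n ⟩
    ⌊log₂ n ⌋                         ∎)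
    where
    open ℕ.≤-Reasoning
    pow≤n : 2 ^ℕ suc ⌊log₂ n ⌋ ≤ n
    pow≤n = subst (_≤ n) (ℕ.*-comm (2 ^ℕ ⌊log₂ n ⌋) 2)
      -- The initial bound is `2` because `i` is a descendant of itself.
      (chain-size ⌊log₂ n ⌋ 2 chain (s≤s (card-nonempty (reaches? i) (i , 0 , refl))))

lookup-ext : ∀ {A : Set} {n} {xs ys : Vec A n} → (∀ i → lookup xs i ≡ lookup ys i) → xs ≡ ys
lookup-ext {xs = xs} {ys} eq =
  trans (sym (Vec.tabulate∘lookup xs)) (trans (Vec.tabulate-cong eq) (Vec.tabulate∘lookup ys))

-- Literals on the values 0, 1, 2.

val : Fin 3 → Bool → Fin 3
val t b = if b then t else 0F

isNull : Maybe Label → Bool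
isNull (just null) = true
isNull _           = false

-- A vertex of range {0,1} hides its value from signed arcs, which test for 2,
-- and a vertex of range {0,2} from null arcs, which test for 1.
ceiling : Bool → Fin 3
ceiling keepsNull = if keepsNull then 1F else 2F

-- b complements the output, which exchanges positive and negative.
literal : (b e : Bool) → Maybe Label → Fin 3 → Bool
literal b e nothing         v = true
literal b e (just positive) v = does (v Fin.≟ 2F) xor b
literal b e (just negative) v = does (v Fin.≟ 2F) xor not b
literal b e (just null)     v = does (v Fin.≟ 1F) xor e

literal-satisfiable : ∀ b e m → ∃[ v ] (literal b e m v ≡ true)
literal-satisfiable b     e     nothing         = 0F , refl
literal-satisfiable false e     (just positive) = 2F , refl
literal-satisfiable true  e     (just positive) = 0F , refl
literal-satisfiable false e     (just negative) = 0F , refl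
literal-satisfiable true  e     (just negative) = 2F , refl
literal-satisfiable b     false (just null)     = 1F , refl
literal-satisfiable b     true  (just null)     = 0F , refl

-- The complementation that makes the test x = 2 (if e is false) or x ≠ 2 (if
-- e is true) the literal of an arc with the given label.
complementation : Maybe Label → Bool → Bool
complementation (just positive) e = e
complementation (just negative) e = not e
complementation (just null)     e = false
complementation nothing         e = false

-- With this complementation every literal is its test xor `e`. The ceiling here is the tested
-- value, so the test returns `e` and the two cancel.
literal-at-limit : ∀ s e →
  literal (complementation (just s) e) e (just s) (val (ceiling (isNull (just s))) e) ≡ false
literal-at-limit positive false = refl
literal-at-limit positive true  = refl
literal-at-limit negative false = refl
literal-at-limit negative true  = refl
literal-at-limit null     false = refl
literal-at-limit null     true  = refl

-- The ceiling is the nonzero value not tested for, so the test fails for either `b`; `e = false`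
-- makes the literal the bare test.
literal-on-range : ∀ s b →
  literal (complementation (just s) false) false (just s) (val (ceiling (not (isNull (just s)))) b) ≡ false
literal-on-range positive false = refl
literal-on-range positive true  = refl
literal-on-range negative false = refl
literal-on-range negative true  = refl
literal-on-range null     false = refl
literal-on-range null     true  = refl

xor-cancel : ∀ x b → (x xor b) xor b ≡ x
xor-cancel false false = refl
xor-cancel false true  = refl
xor-cancel true  false = refl
xor-cancel true  true  = refl

xor-cancel-not : ∀ x b → (x xor not b) xor b ≡ not x
xor-cancel-not false false = refl
xor-cancel-not false true  = refl
xor-cancel-not true  false = refl
xor-cancel-not true  true  = refl

-- Reading off the labels of an interaction graph.

module _ {q n : ℕ} (f : FunctionOver q n) (j i : Fin n) where

  label-nothing : ¬ Arc f j i → interactionGraph f j i ≡ nothing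
  label-nothing ¬arc with arc? f j i
  ... | yes arc = contradiction arc ¬arc
  ... | no  _   = refl

  label-positive : Arc f j i → NonDecreasing f j i → interactionGraph f j i ≡ just positive
  label-positive arc inc with arc? f j i | nonDecreasing? f j i
  ... | yes _   | yes _   = refl
  ... | yes _   | no ¬inc = contradiction inc ¬inc
  ... | no ¬arc | _       = contradiction arc ¬arc

  label-negative : Arc f j i → ¬ NonDecreasing f j i → NonIncreasing f j i →
    interactionGraph f j i ≡ just negative
  label-negative arc ¬inc dec with arc? f j i | nonDecreasing? f j i | nonIncreasing? f j i
  ... | yes _   | yes inc | _       = contradiction inc ¬inc
  ... | yes _   | no _    | yes _   = refl
  ... | yes _   | no _    | no ¬dec = contradiction dec ¬dec
  ... | no ¬arc | _       | _       = contradiction arc ¬arc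

  label-null : Arc f j i → ¬ NonDecreasing f j i → ¬ NonIncreasing f j i →
    interactionGraph f j i ≡ just null
  label-null arc ¬inc ¬dec with arc? f j i | nonDecreasing? f j i | nonIncreasing? f j i
  ... | yes _   | yes inc | _       = contradiction inc ¬inc
  ... | yes _   | no _    | yes dec = contradiction dec ¬dec
  ... | yes _   | no _    | no _    = refl
  ... | no ¬arc | _       | _       = contradiction arc ¬arc

val-increasing : ∀ t (u v : Fin 3) → u Fin.< v →
  val t (does (u Fin.≟ 2F)) Fin.≤ val t (does (v Fin.≟ 2F))
val-increasing t 0F v  _ = z≤n
val-increasing t 1F v  _ = z≤n
val-increasing t 2F 2F (s≤s (s≤s ()))

val-decreasing : ∀ t (u v : Fin 3) → u Fin.< v →
  val t (not (does (v Fin.≟ 2F))) Fin.≤ val t (not (does (u Fin.≟ 2F)))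
val-decreasing t u  2F _ = z≤n
val-decreasing t 0F 1F _ = Fin.≤-refl
val-decreasing t 1F 1F (s≤s ())
val-decreasing t 2F 1F (s≤s ())

ceiling-positive : ∀ k → ¬ ceiling k Fin.≤ zero {2}
ceiling-positive true  ()
ceiling-positive false ()

-- The function `f` and its convergence.

module Construction {n : ℕ} (G : SignedDigraph n) where

  abstract
    inNeighbour : ∀ i → ∃[ j ] (is-just (G j i) ≡ true ⊎ (∀ k → G k i ≡ nothing))
    inNeighbour i with Fin.any? (λ k → is-just (G k i) Bool.≟ true)
    ... | yes (j , arc) = j , inj₁ arc
    -- A vertex without in-neighbours becomes a fixed point of `φ`. It is then periodic, so it never
    -- survives.
    ... | no ¬arc       = i , inj₂ λ k → absent (λ eq → ¬arc (k , eq))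
      where
      absent : ∀ {m : Maybe Label} → is-just m ≢ true → m ≡ nothing
      absent {just _}  ¬eq = contradiction refl ¬eq
      absent {nothing} ¬eq = refl

  φ : Fin n → Fin n
  φ i = proj₁ (inNeighbour i)

  open LighterClass φ (λ i → isNull (G (φ i) i))

  top : Fin n → Fin 3
  top i = ceiling (keep i)

  -- `flip` must satisfy `flip-equation`, a recursion that follows surviving arcs up `φ` and stops
  -- at the first blocked one. The first argument is fuel; `¬long-chain` shows that `suc ⌊log₂ n ⌋`
  -- is enough of it.
  flipUpTo : ℕ → Fin n → Bool
  flipUpTo zero    i = false
  flipUpTo (suc d) i = complementation (G (φ i) i) (does (survives? i) ∧ flipUpTo d (φ i))

  flipUpTo-stable : ∀ d i → ¬ Chain d i → flipUpTo (suc d) i ≡ flipUpTo d i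
  flipUpTo-stable zero    i ¬chain = contradiction tt ¬chain
  flipUpTo-stable (suc d) i ¬chain with survives? i
  ... | no  _    = refl
  ... | yes surv = cong (complementation (G (φ i) i))
    (flipUpTo-stable d (φ i) (λ chain → ¬chain (surv , chain)))

  abstract
    flip : Fin n → Bool
    flip = flipUpTo (suc ⌊log₂ n ⌋)

    flip-equation : ∀ i → flip i ≡ complementation (G (φ i) i) (does (survives? i) ∧ flip (φ i))
    flip-equation i = sym (flipUpTo-stable (suc ⌊log₂ n ⌋) i (¬long-chain i))

  carry : Fin n → Bool
  carry i = does (survives? i) ∧ flip (φ i)

  lit : Fin n → Fin n → Fin 3 → Bool
  lit i k = literal (flip i) (carry i) (G k i)

  holds? : ∀ i x k → Dec (lit i k (lookup x k) ≡ true)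
  holds? i x k = lit i k (lookup x k) Bool.≟ true

  -- The first factor makes the empty conjunction false, so a vertex without in-neighbours takes its
  -- `limit` at once.
  conj : Fin n → State 3 n → Bool
  conj i x = is-just (G (φ i) i) ∧ does (Fin.all? (holds? i x))

  f : FunctionOver 3 n
  f x = tabulate λ i → val (top i) (conj i x xor flip i)

  lookup-f : ∀ x i → lookup (f x) i ≡ val (top i) (conj i x xor flip i)
  lookup-f x i = Vec.lookup∘tabulate _ i

  limit : Fin n → Fin 3
  limit i = val (top i) (flip i)

  conj-false : ∀ i x →
    (∀ s → G (φ i) i ≡ just s → lit i (φ i) (lookup x (φ i)) ≡ false) → conj i x ≡ false
  conj-false i x h = by-label (G (φ i) i) refl
    where
    by-label : ∀ m → G (φ i) i ≡ m → conj i x ≡ false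
    by-label nothing  eq = cong (λ m → is-just m ∧ does (Fin.all? (holds? i x))) eq
    by-label (just s) eq = trans
      (cong (is-just (G (φ i) i) ∧_) (dec-false (Fin.all? (holds? i x))
        λ all → contradiction (trans (sym (h s eq)) (all (φ i))) λ ()))
      (Bool.∧-zeroʳ _)

  lit-designated : ∀ i {s e} y → G (φ i) i ≡ just s → carry i ≡ e →
    lit i (φ i) y ≡ literal (complementation (just s) e) e (just s) y
  lit-designated i y eq eq′ = trans
    (cong (λ b → literal b (carry i) (G (φ i) i) y) (flip-equation i))
    (cong₂ (λ m e → literal (complementation m e) e m y) eq eq′)

  conj-at-limit : ∀ i x → Survives i → lookup x (φ i) ≡ limit (φ i) → conj i x ≡ false
  conj-at-limit i x surv eq = conj-false i x λ s Gs →
    trans (lit-designated i (lookup x (φ i)) Gs (cong (_∧ flip (φ i)) (dec-true (survives? i) surv)))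
      (trans (cong (literal _ (flip (φ i)) (just s))
        (trans eq (cong (λ k → val (ceiling k) (flip (φ i))) (trans (sym surv) (cong isNull Gs)))))
      (literal-at-limit s (flip (φ i))))

  conj-on-range : ∀ i x → ¬ Survives i → conj i (f x) ≡ false
  conj-on-range i x ¬surv = conj-false i (f x) λ s Gs →
    trans (lit-designated i (lookup (f x) (φ i)) Gs (cong (_∧ flip (φ i)) (dec-false (survives? i) ¬surv)))
      (trans (cong (literal _ false (just s))
        (trans (lookup-f x (φ i)) (cong (λ k → val (ceiling k) (conj (φ i) x xor flip (φ i)))
          (Bool.¬-not λ eq → ¬surv (trans (cong isNull Gs) (sym eq))))))
      (literal-on-range s (conj (φ i) x xor flip (φ i))))

  -- Induction up the chain: a vertex settles one step after its selected in-neighbour. The exponent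
  -- is `suc d` and not `d` because a blocked arc fixes its target only on the range of `f`, which
  -- takes one application to enter.
  converges : ∀ d i x → ¬ Chain d i → lookup ((f ^ suc d) x) i ≡ limit i
  converges zero    i x ¬chain = contradiction tt ¬chain
  converges (suc d) i x ¬chain =
    trans (lookup-f ((f ^ suc d) x) i) (cong (λ c → val (top i) (c xor flip i)) (by-survival (survives? i)))
    where
    by-survival : Dec (Survives i) → conj i ((f ^ suc d) x) ≡ false
    by-survival (yes surv) = conj-at-limit i ((f ^ suc d) x) surv
      (converges d (φ i) x (λ chain → ¬chain (surv , chain)))
    by-survival (no ¬surv) = conj-on-range i ((f ^ d) x) ¬surv

  constant : Constant (f ^ (⌊log₂ n ⌋ + 2))
  constant a b = subst (λ k → (f ^ k) a ≡ (f ^ k) b) (ℕ.+-comm 2 ⌊log₂ n ⌋)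
    (lookup-ext λ i → trans (converges (suc ⌊log₂ n ⌋) i a (¬long-chain i)) (sym (converges (suc ⌊log₂ n ⌋) i b (¬long-chain i))))

  -- Dependence of `f` on a single coordinate, and its interaction graph.

  section : Fin n → Fin n → Fin 3 → Fin 3
  section k i v = val (top i) (lit i k v xor flip i)

  Others : Fin n → Fin n → State 3 n → Set
  Others k i x = ∀ l → l ≢ k → lit i l (lookup x l) ≡ true

  others? : ∀ k i x → Dec (Others k i x)
  others? k i x = Fin.all? λ l → ¬? (l Fin.≟ k) →-dec holds? i x l

  others-cong : ∀ k i a b → (∀ l → l ≢ k → lookup a l ≡ lookup b l) → Others k i a → Others k i b
  others-cong k i a b a≈b others l l≢k = subst (λ y → lit i l y ≡ true) (a≈b l l≢k) (others l l≢k)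

  conj-others : ∀ k i x → is-just (G (φ i) i) ≡ true → Others k i x → conj i x ≡ lit i k (lookup x k)
  conj-others k i x arc others =
    cong₂ _∧_ arc (by-value (lit i k (lookup x k)) refl)
    where
    by-value : ∀ b → lit i k (lookup x k) ≡ b → does (Fin.all? (holds? i x)) ≡ lit i k (lookup x k)
    by-value false eq = trans
      (dec-false (Fin.all? (holds? i x)) λ all → contradiction (trans (sym eq) (all k)) λ ()) (sym eq)
    by-value true  eq = trans (dec-true (Fin.all? (holds? i x)) all) (sym eq)
      where
      all : ∀ l → lit i l (lookup x l) ≡ true
      all l with l Fin.≟ k
      ... | yes refl = eq
      ... | no  l≢k  = others l l≢k

  conj-¬others : ∀ k i x → ¬ Others k i x → conj i x ≡ false
  conj-¬others k i x ¬others = trans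
    (cong (is-just (G (φ i) i) ∧_) (dec-false (Fin.all? (holds? i x)) λ all → ¬others λ l _ → all l))
    (Bool.∧-zeroʳ _)

  f-section : ∀ k i x → is-just (G (φ i) i) ≡ true → Others k i x → lookup (f x) i ≡ section k i (lookup x k)
  f-section k i x arc others =
    trans (lookup-f x i) (cong (λ c → val (top i) (c xor flip i)) (conj-others k i x arc others))

  f-cong : ∀ i a b → conj i a ≡ conj i b → lookup (f a) i ≡ lookup (f b) i
  f-cong i a b eq =
    trans (lookup-f a i) (trans (cong (λ c → val (top i) (c xor flip i)) eq) (sym (lookup-f b i)))

  -- The literals of coordinates other than `k` agree at `a` and `b`. If one is false, it fixes the
  -- conjunction at both states; otherwise only the literal of `k` is left. Monotonicity of
  -- `section` thus passes to `f`.
  f-dichotomy : ∀ k i a b → a <[ k ] b →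
    lookup (f a) i ≡ lookup (f b) i ⊎
    (lookup (f a) i ≡ section k i (lookup a k) × lookup (f b) i ≡ section k i (lookup b k))
  f-dichotomy k i a b (_ , a≈b) with is-just (G (φ i) i) Bool.≟ true | others? k i a
  ... | no ¬arc | _           = inj₁ (f-cong i a b (trans (no-arc a) (sym (no-arc b))))
    where
    no-arc : ∀ x → conj i x ≡ false
    no-arc x = cong (_∧ does (Fin.all? (holds? i x))) (Bool.¬-not ¬arc)
  ... | yes arc | yes others = inj₂ (f-section k i a arc others , f-section k i b arc (others-cong k i a b a≈b others))
  ... | yes arc | no ¬others = inj₁ (f-cong i a b (trans (conj-¬others k i a ¬others)
    (sym (conj-¬others k i b λ others → ¬others (others-cong k i b a (λ l l≢k → sym (a≈b l l≢k)) others)))))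

  module _ (k i : Fin n) (s : Label) (Gki : G k i ≡ just s) where

    hasArc : is-just (G (φ i) i) ≡ true
    hasArc with proj₂ (inNeighbour i)
    ... | inj₁ arc  = arc
    ... | inj₂ none = contradiction (trans (sym Gki) (none k)) λ ()

    default : Fin n → Fin 3
    default l = proj₁ (literal-satisfiable (flip i) (carry i) (G l i))

    -- A state that satisfies all literals except possibly that of `k`, so that `f` displays the
    -- whole of `section k i` as `u` varies. This transfers properties of `f` back to the section.
    context : Fin 3 → State 3 n
    context u = tabulate λ l → if does (l Fin.≟ k) then u else default l

    context-at : ∀ u → lookup (context u) k ≡ u
    context-at u = trans (Vec.lookup∘tabulate _ k) (cong (if_then u else default k) (dec-true (k Fin.≟ k) refl))

    context-off : ∀ u l → l ≢ k → lookup (context u) l ≡ default l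
    context-off u l l≢k = trans (Vec.lookup∘tabulate _ l) (cong (if_then u else default l) (dec-false (l Fin.≟ k) l≢k))

    context-< : ∀ {u v} → u Fin.< v → context u <[ k ] context v
    context-< {u} {v} u<v =
      subst₂ Fin._<_ (sym (context-at u)) (sym (context-at v)) u<v ,
      λ l l≢k → trans (context-off u l l≢k) (sym (context-off v l l≢k))

    f-context : ∀ u → lookup (f (context u)) i ≡ section k i u
    f-context u = trans
      (f-section k i (context u) hasArc λ l l≢k → trans (cong (lit i l) (context-off u l l≢k))
        (proj₂ (literal-satisfiable (flip i) (carry i) (G l i))))
      (cong (section k i) (context-at u))

  arc-from-section : ∀ {k i s} → G k i ≡ just s → ∀ {u v} → u Fin.< v →
    section k i u ≢ section k i v → Arc f k i
  arc-from-section {k} {i} {s} Gki {u} {v} u<v ne =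
    context k i s Gki u , context k i s Gki v , context-< k i s Gki u<v ,
    λ eq → ne (trans (sym (f-context k i s Gki u)) (trans eq (f-context k i s Gki v)))

  nonDecreasing-section : ∀ {k i s} → G k i ≡ just s → NonDecreasing f k i →
    ∀ {u v} → u Fin.< v → section k i u Fin.≤ section k i v
  nonDecreasing-section {k} {i} {s} Gki inc {u} {v} u<v =
    subst₂ Fin._≤_ (f-context k i s Gki u) (f-context k i s Gki v) (inc (context k i s Gki u) (context k i s Gki v) (context-< k i s Gki u<v))

  nonIncreasing-section : ∀ {k i s} → G k i ≡ just s → NonIncreasing f k i →
    ∀ {u v} → u Fin.< v → section k i v Fin.≤ section k i u
  nonIncreasing-section {k} {i} {s} Gki dec {u} {v} u<v =
    subst₂ Fin._≤_ (f-context k i s Gki v) (f-context k i s Gki u) (dec (context k i s Gki u) (context k i s Gki v) (context-< k i s Gki u<v))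

  section-nonDecreasing : ∀ k i → (∀ u v → u Fin.< v → section k i u Fin.≤ section k i v) → NonDecreasing f k i
  section-nonDecreasing k i inc a b a<b with f-dichotomy k i a b a<b
  ... | inj₁ eq        = Fin.≤-reflexive eq
  ... | inj₂ (ea , eb) = subst₂ Fin._≤_ (sym ea) (sym eb) (inc (lookup a k) (lookup b k) (proj₁ a<b))

  section-nonIncreasing : ∀ k i → (∀ u v → u Fin.< v → section k i v Fin.≤ section k i u) → NonIncreasing f k i
  section-nonIncreasing k i dec a b a<b with f-dichotomy k i a b a<b
  ... | inj₁ eq        = Fin.≤-reflexive (sym eq)
  ... | inj₂ (ea , eb) = subst₂ Fin._≤_ (sym eb) (sym ea) (dec (lookup a k) (lookup b k) (proj₁ a<b))

  section-label : ∀ {k i m} → G k i ≡ m → ∀ v →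
    section k i v ≡ val (top i) (literal (flip i) (carry i) m v xor flip i)
  section-label {k} {i} eq v = cong (λ m → val (top i) (literal (flip i) (carry i) m v xor flip i)) eq

  section-positive : ∀ {k i} → G k i ≡ just positive → ∀ v → section k i v ≡ val (top i) (does (v Fin.≟ 2F))
  section-positive {i = i} eq v = trans (section-label eq v) (cong (val (top i)) (xor-cancel (does (v Fin.≟ 2F)) (flip i)))

  section-negative : ∀ {k i} → G k i ≡ just negative → ∀ v → section k i v ≡ val (top i) (not (does (v Fin.≟ 2F)))
  section-negative {i = i} eq v = trans (section-label eq v) (cong (val (top i)) (xor-cancel-not (does (v Fin.≟ 2F)) (flip i)))

  section-null : ∀ {k i} → G k i ≡ just null → ∀ v →
    section k i v ≡ val (top i) (does (v Fin.≟ 1F) xor (carry i xor flip i))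
  section-null {i = i} eq v = trans (section-label eq v)
    (cong (val (top i)) (Bool.xor-assoc (does (v Fin.≟ 1F)) (carry i) (flip i)))

  top-positive : ∀ i → ¬ top i Fin.≤ zero {2}
  top-positive i = ceiling-positive (keep i)

  admits : Admits G f
  admits k i = by-label (G k i) refl
    where
    by-label : ∀ m → G k i ≡ m → interactionGraph f k i ≡ m
    by-label nothing eq = label-nothing f k i λ (a , b , a<b , ne) → ne (equal a b a<b)
      where
      equal : ∀ a b → a <[ k ] b → lookup (f a) i ≡ lookup (f b) i
      equal a b a<b with f-dichotomy k i a b a<b
      ... | inj₁ e         = e
      ... | inj₂ (ea , eb) = trans ea (trans (section-label eq (lookup a k)) (trans (sym (section-label eq (lookup b k))) (sym eb)))
    -- A signed section changes only between `1` and `2`, so this pair witnesses the arc.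
    by-label (just positive) eq = label-positive f k i
      (arc-from-section eq {1F} {2F} (s≤s (s≤s z≤n))
        λ e → top-positive i (Fin.≤-reflexive (trans (sym (at 2F)) (trans (sym e) (at 1F)))))
      (section-nonDecreasing k i λ u v u<v → subst₂ Fin._≤_ (sym (at u)) (sym (at v)) (val-increasing (top i) u v u<v))
      where at = section-positive eq
    by-label (just negative) eq = label-negative f k i
      (arc-from-section eq {1F} {2F} (s≤s (s≤s z≤n))
        λ e → top-positive i (Fin.≤-reflexive (trans (sym (at 1F)) (trans e (at 2F)))))
      (λ inc → top-positive i (subst₂ Fin._≤_ (at 1F) (at 2F) (nonDecreasing-section eq inc (s≤s (s≤s z≤n)))))
      (section-nonIncreasing k i λ u v u<v → subst₂ Fin._≤_ (sym (at v)) (sym (at u)) (val-decreasing (top i) u v u<v))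
      where at = section-negative eq
    -- The test for the middle value `1` makes the section a peak (`false`) or a valley (`true`).
    -- Either way it has a strict rise and a strict fall, which refute both monotonicities.
    by-label (just null) eq with carry i xor flip i | section-null eq
    ...   | false | at = label-null f k i
      (arc-from-section eq {1F} {2F} (s≤s (s≤s z≤n))
        λ e → top-positive i (Fin.≤-reflexive (trans (sym (at 1F)) (trans e (at 2F)))))
      (λ inc → top-positive i (subst₂ Fin._≤_ (at 1F) (at 2F) (nonDecreasing-section eq inc (s≤s (s≤s z≤n)))))
      (λ dec → top-positive i (subst₂ Fin._≤_ (at 1F) (at 0F) (nonIncreasing-section eq dec (s≤s z≤n))))
    ...   | true | at = label-null f k i
      (arc-from-section eq {0F} {1F} (s≤s z≤n)
        λ e → top-positive i (Fin.≤-reflexive (trans (sym (at 0F)) (trans e (at 1F)))))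
      (λ inc → top-positive i (subst₂ Fin._≤_ (at 0F) (at 1F) (nonDecreasing-section eq inc (s≤s z≤n))))
      (λ dec → top-positive i (subst₂ Fin._≤_ (at 2F) (at 1F) (nonIncreasing-section eq dec (s≤s (s≤s z≤n)))))

-- The class as a least exponent.

least : ∀ {P : ℕ → Set} → (∀ k → Dec (P k)) → ∀ k → P k → ∃[ m ] ((P m × (∀ l → P l → m ≤ l)) × m ≤ k)
least P? k p with P? 0
... | yes p₀ = 0 , (p₀ , λ _ _ → z≤n) , z≤n
least P? zero    p | no ¬p₀ = contradiction p ¬p₀
least {P} P? (suc k) p | no ¬p₀ with least (P? ∘ suc) k p
... | m , (pm , min) , m≤k = suc m , (pm , min′) , s≤s m≤k
  where
  min′ : ∀ l → P l → suc m ≤ l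
  min′ zero    p₀ = contradiction p₀ ¬p₀
  min′ (suc l) pl = s≤s (min l pl)

constant? : ∀ {q n} (g : FunctionOver q n) → Dec (Constant g)
constant? {n = n} g = ∀State? n λ a → ∀State? n λ b → Vec.≡-dec Fin._≟_ (g a) (g b)

theorem1 : ∀ (n : ℕ) → n ≥ 1 → (G : SignedDigraph n) →
    ∃[ f ] (Admits {3} {n} G f × Nilpotent f × ∃[ k ] (IsClass f k × k ≤ ⌊log₂ n ⌋ + 2))
theorem1 n _ G = f , admits , (⌊log₂ n ⌋ + 2 , constant) ,
  least (λ k → constant? (f ^ k)) (⌊log₂ n ⌋ + 2) constant
  where open Construction G
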